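{- For every signed graph $(G,\sigma)$ and every positive integer $k$, $\chi\big(\hat{G}^{[-k]}\big)\le \mathrm{wcol}_{2k}(G)$. Moreover, if $k$ is odd, then $\chi\big(\hat{G}^{[-k]}\big)\le \mathrm{wcol}_{2k-1}(G)$.
   Context: A signed graph $(G,\sigma)$ is a finite simple graph $G$ with $\sigma:E(G)\to\{+,-\}$; the sign of a path is the product of its edge signs. For a positive integer $k$, $\hat{G}^{[-k]}$ is the graph on $V(G)$ in which $xy$ is an edge iff $d_G(x,y)=k$ and every $xy$-path of length $k$ is negative. For a total ordering $L$ of $V(G)$ and $y\in V(G)$, a vertex $x$ is weakly $r$-reachable from $y$ if there is an $xy$-path $P$ of length at most $r$ with $x\le_L z$ for all vertices $z$ of $P$; $\mathrm{WReach}_r[G,L,y]$ is the set of such $x$ (including $y$ itself). $\mathrm{wcol}_r(G)=\min_L\max_{v\in V(G)}|\mathrm{WReach}_r[G,L,v]|$. -}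

module Defs where

open import Data.Nat using (ℕ; zero; suc; _≤_; _<_)
open import Data.Fin using (Fin)
import Data.Fin as F
open import Data.Bool using (Bool; true; false)
open import Data.Vec using (Vec; []; _∷_; head; last; toList)
open import Data.Vec.Relation.Unary.All using (All)
open import Data.List.Relation.Unary.Unique.Propositional using (Unique)
open import Data.Fin.Subset using (Subset; _∈_; ∣_∣)
open import Data.Fin.Permutation using (Permutation′; _⟨$⟩ʳ_)
open import Data.Product using (Σ; _×_; _,_)
open import Data.Unit using (⊤)
open import Data.Empty using (⊥)
open import Relation.Binary.PropositionalEquality using (_≡_; _≢_)

data Sign : Set where
  pos neg : Sign

_·_ : Sign → Sign → Sign
pos · s = s
neg · pos = neg
neg · neg = pos

record Graph (n : ℕ) : Set where
  field
    adj     : Fin n → Fin n → Bool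
    adj-sym : ∀ x y → adj x y ≡ adj y x
    adj-irr : ∀ x → adj x x ≡ false

-- A signed graph: a graph together with a signature sigma.  The signature is
-- given as a symmetric function on all pairs; only its values on edges matter.
record SignedGraph (n : ℕ) : Set where
  field
    graph : Graph n
    σ     : Fin n → Fin n → Sign
    σ-sym : ∀ x y → σ x y ≡ σ y x
  open Graph graph public

module _ {n : ℕ} (G : Graph n) where
  open Graph G

  IsWalk : ∀ {m} → Vec (Fin n) (suc m) → Set
  IsWalk (v ∷ []) = ⊤
  IsWalk (u ∷ v ∷ vs) = (adj u v ≡ true) × IsWalk (v ∷ vs)

  record Path (x y : Fin n) (m : ℕ) : Set where
    field
      vs       : Vec (Fin n) (suc m)
      start    : head vs ≡ x
      end      : last vs ≡ y
      walk     : IsWalk vs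
      distinct : Unique (toList vs)

  Dist : Fin n → Fin n → ℕ → Set
  Dist x y k = Path x y k × (∀ j → j < k → Path x y j → ⊥)

  WReachable : Permutation′ n → ℕ → Fin n → Fin n → Set
  WReachable L r y x =
    Σ ℕ λ m → m ≤ r × Σ (Path x y m) λ P →
      All (λ z → (L ⟨$⟩ʳ x) F.≤ (L ⟨$⟩ʳ z)) (Path.vs P)

signOf : ∀ {n m} → (Fin n → Fin n → Sign) → Vec (Fin n) (suc m) → Sign
signOf σ (v ∷ []) = pos
signOf σ (u ∷ v ∷ vs) = σ u v · signOf σ (v ∷ vs)

NegHat : ∀ {n} → SignedGraph n → ℕ → Fin n → Fin n → Set
NegHat Gσ k x y =
  Dist graph x y k × (∀ (P : Path graph x y k) → signOf σ (Path.vs P) ≡ neg)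
  where open SignedGraph Gσ

ChromaticAtMost : ∀ {n} → (Fin n → Fin n → Set) → ℕ → Set
ChromaticAtMost {n} E c =
  Σ (Fin n → Fin c) λ f → ∀ x y → E x y → f x ≢ f y

HasSize : ∀ {n} → (Fin n → Set) → ℕ → Set
HasSize {n} P s =
  Σ (Subset n) λ S → (∀ x → (x ∈ S → P x) × (P x → x ∈ S)) × ∣ S ∣ ≡ s

-- m = max_v |WReach_r[G,L,v]|  (least upper bound; 0 for the empty graph)
IsMaxWReach : ∀ {n} → Graph n → ℕ → Permutation′ n → ℕ → Set
IsMaxWReach {n} G r L m =
  (∀ v s → HasSize (WReachable G L r v) s → s ≤ m) ×
  (∀ m′ → (∀ v s → HasSize (WReachable G L r v) s → s ≤ m′) → m ≤ m′)

IsWcol : ∀ {n} → Graph n → ℕ → ℕ → Set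
IsWcol {n} G r w =
  (Σ (Permutation′ n) λ L → IsMaxWReach G r L w) ×
  (∀ (L : Permutation′ n) w′ → IsMaxWReach G r L w′ → w ≤ w′)

{-# OPTIONS --safe #-}
-- Let B(x) consist of the vertices z joined to x by a walk of length j with
-- 2j < k, or with 2j = k and positive sign.  If xy is an edge of the graph
-- NegHat, then B(x) and B(y) are disjoint (a common vertex would give either an
-- xy-walk shorter than k or a positive one of length k), and they cover every
-- shortest xy-path (a negative path splits at its midpoint, if it has one, into
-- a positive and a negative half).  Let m(x) be the L-least vertex of B(x).
-- Going from m(x) to x, then to y, then to m(y), we stay inside B(x) ∪ B(y), so
-- the smaller of m(x) ≠ m(y) is weakly reachable from the other.  Hence x ↦ φ(m(x))
-- is proper whenever φ is a greedy colouring along L in which every vertex avoids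
-- the colours of all the vertices weakly reachable from it.
module Submission where

open import Defs
open import Data.Nat using (ℕ; zero; suc; _≤_; _<_; _*_; _+_; _∸_; z≤n; s≤s)
open import Data.Nat.Properties
open import Data.Nat.Induction using (<-wellFounded)
open import Data.Nat.Tactic.RingSolver using (solve-∀)
open import Axiom.UniquenessOfIdentityProofs.WithK using (uip)
open import Induction.WellFounded using (Acc; acc)
open import Data.Bool using (true)
import Data.Bool.Properties as Bool
open import Data.Fin using (Fin; zero; suc; toℕ; fromℕ<)
import Data.Fin as F
import Data.Fin.Properties as F
open import Data.Fin.Permutation using (Permutation′; _⟨$⟩ʳ_; _⟨$⟩ˡ_; inverseˡ; inverseʳ)
open import Data.Fin.Subset using (Subset; _∈_; ∣_∣; _-_)
open import Data.Fin.Subset.Properties using (_∈?_; x∈p⇒∣p-x∣<∣p∣; x∈p∧x≢y⇒x∈p-y)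
open import Data.List using (allFin; filter)
import Data.List.Relation.Unary.All as List
import Data.List.Relation.Unary.All.Properties as List
open import Data.List.Relation.Unary.AllPairs using ([]; _∷_)
open import Data.List.Relation.Unary.Unique.Propositional using (Unique)
open import Data.List.Membership.Propositional.Properties using (∈-allFin; ∈-filter⁺)
open import Data.List.Extrema.Nat using (argmin; argmin-all; f[argmin]≤f[xs])
open import Data.Vec using (Vec; []; _∷_; head; last; toList; tabulate)
open import Data.Vec.Properties using (lookup⇒[]=; []=⇒lookup; lookup∘tabulate)
open import Data.Vec.Relation.Unary.All as All using (All; []; _∷_)
open import Data.Vec.Relation.Unary.All.Properties using (lookup⁻)
open import Data.Vec.Relation.Unary.Any using (here; there)
open import Data.Vec.Membership.Propositional.Properties using (∈-lookup; ∈-toList⁻)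
open import Data.Vec.Membership.Propositional using () renaming (_∈_ to _∈ᵛ_)
import Data.Vec.Membership.DecPropositional as DecMem
open import Data.Product using (Σ; ∃; ∃-syntax; Σ-syntax; _×_; _,_; proj₁; proj₂)
open import Data.Sum using (_⊎_; inj₁; inj₂)
open import Data.Unit using (tt)
open import Function using (_∘_; Injective)
open import Relation.Nullary using (Dec; yes; no; does; ¬_; contradiction)
open import Relation.Nullary.Decidable using (map′; dec-true; _×-dec_; _⊎-dec_; _→-dec_; ¬?)
open import Relation.Unary using (Decidable)
open import Relation.Binary using (DecidableEquality; tri<; tri≈; tri>)
open import Relation.Binary.PropositionalEquality

-- Arithmetic of signs.

·-assoc : ∀ a b c → (a · b) · c ≡ a · (b · c)
·-assoc pos b   c   = refl
·-assoc neg pos c   = refl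
·-assoc neg neg pos = refl
·-assoc neg neg neg = refl

·-comm : ∀ a b → a · b ≡ b · a
·-comm pos pos = refl
·-comm pos neg = refl
·-comm neg pos = refl
·-comm neg neg = refl

_≟ˢ_ : DecidableEquality Sign
pos ≟ˢ pos = yes refl
pos ≟ˢ neg = no λ ()
neg ≟ˢ pos = no λ ()
neg ≟ˢ neg = yes refl

-- Finite counting and greedy colouring.

module _ {n : ℕ} where

  decidable⇒subset : {P : Fin n → Set} → Decidable P →
    Σ[ S ∈ Subset n ] (∀ x → (x ∈ S → P x) × (P x → x ∈ S))
  decidable⇒subset {P} P? = S , λ x → to x , from x
    where
    S = tabulate (does ∘ P?)
    to : ∀ x → x ∈ S → P x
    to x x∈S with P? x | trans (sym (lookup∘tabulate (does ∘ P?) x)) ([]=⇒lookup x∈S)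
    ... | yes p | _ = p
    ... | no _  | ()
    from : ∀ x → P x → x ∈ S
    from x p = lookup⇒[]= x S (trans (lookup∘tabulate (does ∘ P?) x) (dec-true (P? x) p))

  injective-into⇒≤ : ∀ {m} (T : Subset n) (g : Fin m → Fin n) →
    Injective _≡_ _≡_ g → (∀ i → g i ∈ T) → m ≤ ∣ T ∣
  injective-into⇒≤ {zero}  T g inj g∈T = z≤n
  injective-into⇒≤ {suc m} T g inj g∈T = ≤-trans
    (s≤s (injective-into⇒≤ (T - g zero) (g ∘ suc) (F.suc-injective ∘ inj)
      λ i → x∈p∧x≢y⇒x∈p-y (g∈T (suc i)) λ eq → F.0≢1+n (sym (inj eq))))
    (x∈p⇒∣p-x∣<∣p∣ (g∈T zero))

  -- Pigeonhole: if every colour occurred on `T`, choosing one vertex of `T` for each colour would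
  -- inject `Fin w` into `T`.
  fresh-colour : ∀ {w} (φ : Fin n → Fin w) (T : Subset n) → ∣ T ∣ < w →
    ∃[ c ] (∀ x → x ∈ T → φ x ≢ c)
  fresh-colour {w} φ T ∣T∣<w
    with F.any? (λ c → F.all? λ x → (x ∈? T) →-dec ¬? (φ x F.≟ c))
  ... | yes found = found
  ... | no none = contradiction (injective-into⇒≤ T g g-injective g∈T) (<⇒≱ ∣T∣<w)
    where
    preimage : ∀ c → ∃[ x ] (x ∈ T × φ x ≡ c)
    preimage c with F.any? (λ x → (x ∈? T) ×-dec (φ x F.≟ c))
    ... | yes p = p
    ... | no ¬p = contradiction (c , λ x x∈T eq → ¬p (x , x∈T , eq)) none
    g : Fin w → Fin n
    g = proj₁ ∘ preimage
    g∈T : ∀ c → g c ∈ T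
    g∈T c = proj₁ (proj₂ (preimage c))
    g-injective : Injective _≡_ _≡_ g
    g-injective {c} {d} eq = trans (sym (proj₂ (proj₂ (preimage c))))
      (trans (cong φ eq) (proj₂ (proj₂ (preimage d))))

  -- Vertices are treated in the order `L`. When `y` is reached, fewer than `w` vertices other than
  -- `y` lie in `S y`, so some colour is free.
  greedy-colouring : ∀ {w} (L : Permutation′ n) (S : Fin n → Subset n) →
    (∀ {x y} → x ∈ S y → (L ⟨$⟩ʳ x) F.≤ (L ⟨$⟩ʳ y)) →
    (∀ y → y ∈ S y) → (∀ y → ∣ S y ∣ ≤ w) →
    Σ[ φ ∈ (Fin n → Fin w) ] (∀ x y → x ∈ S y → x ≢ y → φ x ≢ φ y)
  greedy-colouring {w} L S S-below S-refl ∣S∣≤w =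
    let φ , proper = prefix n ≤-refl in φ , λ x y → proper x y (F.toℕ<n (L ⟨$⟩ʳ y))
    where
    rank : Fin n → ℕ
    rank x = toℕ (L ⟨$⟩ʳ x)

    room : ∀ y → ∣ S y - y ∣ < w
    room y = <-≤-trans (x∈p⇒∣p-x∣<∣p∣ (S-refl y)) (∣S∣≤w y)

    prefix : ∀ t → t ≤ n → Σ[ φ ∈ (Fin n → Fin w) ]
      (∀ x y → rank y < t → x ∈ S y → x ≢ y → φ x ≢ φ y)
    -- The initial colour is 0. A colour exists because `room y` makes `w` positive; asking for it
    -- only once `y` is given also covers `n = 0`, where `w` may be 0.
    prefix zero    _   = (λ y → fromℕ< (≤-<-trans z≤n (room y))) , λ _ _ ()
    prefix (suc t) t<n = ψ , proper
      where
      IH = prefix t (<⇒≤ t<n)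
      φ  = proj₁ IH
      v  = L ⟨$⟩ˡ fromℕ< t<n
      new = fresh-colour φ (S v - v) (room v)

      rank-v : rank v ≡ t
      rank-v = trans (cong toℕ (inverseʳ L)) (F.toℕ-fromℕ< t<n)

      ≢v⇒rank<t : ∀ {y} → y ≢ v → rank y < suc t → rank y < t
      ≢v⇒rank<t {y} y≢v (s≤s y≤t) = ≤∧≢⇒< y≤t λ y≡t → y≢v (trans (sym (inverseˡ L))
        (cong (L ⟨$⟩ˡ_) (F.toℕ-injective (trans y≡t (sym (F.toℕ-fromℕ< t<n))))))

      ψ : Fin n → Fin w
      ψ y with y F.≟ v
      ... | yes _ = proj₁ new
      ... | no _  = φ y

      proper : ∀ x y → rank y < suc t → x ∈ S y → x ≢ y → ψ x ≢ ψ y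
      proper x y y≤t x∈S x≢y with x F.≟ v | y F.≟ v
      ... | yes refl | yes refl = contradiction refl x≢y
      ... | no _     | yes refl = proj₂ new x (x∈p∧x≢y⇒x∈p-y x∈S x≢y)
      -- Recolouring `v` cannot spoil an earlier `y`: by `S-below`, `v ∈ S y` would give
      -- `t ≤ rank y`.
      ... | yes refl | no y≢v   = λ _ → <⇒≱ (≢v⇒rank<t y≢v y≤t)
                                    (subst (_≤ rank y) rank-v (S-below x∈S))
      ... | no _     | no y≢v   = proj₂ IH x y (≢v⇒rank<t y≢v y≤t) x∈S x≢y

  least : (f : Fin n → ℕ) {P : Fin n → Set} → Decidable P → ∃ P →
    ∃[ m ] (P m × (∀ z → P z → f m ≤ f z))
  least f P? (x , Px) = argmin f x xs ,
    argmin-all f Px (List.all-filter P? (allFin n)) ,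
    λ z Pz → List.lookup (f[argmin]≤f[xs] x xs) (∈-filter⁺ P? (∈-allFin z) Pz)
    where xs = filter P? (allFin n)

-- Walks in a signed graph and the paths they contain.

module _ {n : ℕ} (Gσ : SignedGraph n) where
  open SignedGraph Gσ

  infixr 5 _∷_ _++_

  -- Concatenation and reversal preserve walks, but concatenation may destroy distinctness of
  -- vertices. The argument therefore runs on walks and returns to paths through `toPath`.
  data Walk : Fin n → Fin n → ℕ → Set where
    [_] : ∀ x → Walk x x 0
    _∷_ : ∀ {x y z m} → adj x y ≡ true → Walk y z m → Walk x z (suc m)

  private variable
    x y z : Fin n
    a b k m : ℕ
    Q : Fin n → Set

  -- The start vertex is kept outside of the recursion so that vertices W is
  -- always a cons, as IsWalk and signOf require.
  tailVertices : Walk x y m → Vec (Fin n) m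
  tailVertices [ _ ]             = []
  tailVertices (_∷_ {y = y} _ W) = y ∷ tailVertices W

  vertices : Walk x y m → Vec (Fin n) (suc m)
  vertices {x} W = x ∷ tailVertices W

  sign : Walk x y m → Sign
  sign W = signOf σ (vertices W)

  vertices-last : (W : Walk x y m) → last (vertices W) ≡ y
  vertices-last [ _ ]           = refl
  vertices-last (_ ∷ [ _ ])     = refl
  vertices-last (_ ∷ W@(_ ∷ _)) = vertices-last W

  vertices-walk : (W : Walk x y m) → IsWalk graph (vertices W)
  vertices-walk [ _ ]   = tt
  vertices-walk (e ∷ W) = e , vertices-walk W

  walk→path : (W : Walk x y m) → Unique (toList (vertices W)) → Path graph x y m
  walk→path W u = record
    { vs = vertices W ; start = refl ; end = vertices-last W
    ; walk = vertices-walk W ; distinct = u }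

  fromVec : (vs : Vec (Fin n) (suc m)) → IsWalk graph vs →
    Σ[ W ∈ Walk (head vs) (last vs) m ] vertices W ≡ vs
  fromVec (v ∷ [])     _       = [ v ] , refl
  fromVec (u ∷ v ∷ vs) (e , w) =
    let W , eq = fromVec (v ∷ vs) w in e ∷ W , cong (u ∷_) eq

  path→walk : (P : Path graph x y m) → Σ[ W ∈ Walk x y m ] vertices W ≡ Path.vs P
  path→walk record { vs = vs ; start = refl ; end = refl ; walk = w } = fromVec vs w

  _++_ : Walk x y a → Walk y z b → Walk x z (a + b)
  [ _ ]   ++ V = V
  (e ∷ U) ++ V = e ∷ (U ++ V)

  sign-++ : (U : Walk x y a) (V : Walk y z b) → sign (U ++ V) ≡ sign U · sign V
  sign-++ [ _ ]   V = refl
  sign-++ (_ ∷ U) V = trans (cong (σ _ _ ·_) (sign-++ U V)) (sym (·-assoc (σ _ _) (sign U) (sign V)))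

  All-++⁺ : (U : Walk x y a) (V : Walk y z b) → All Q (vertices U) → All Q (vertices V) →
    All Q (vertices (U ++ V))
  All-++⁺ [ _ ]   V _        qs = qs
  All-++⁺ (_ ∷ U) V (p ∷ ps) qs = p ∷ All-++⁺ U V ps qs

  All-++⁻ʳ : (U : Walk x y a) (V : Walk y z b) → All Q (vertices (U ++ V)) → All Q (vertices V)
  All-++⁻ʳ [ _ ]   V qs       = qs
  All-++⁻ʳ (_ ∷ U) V (_ ∷ qs) = All-++⁻ʳ U V qs

  adj-symmetric : adj x y ≡ true → adj y x ≡ true
  adj-symmetric {x} {y} e = trans (adj-sym y x) e

  snoc : Walk x y m → adj y z ≡ true → Walk x z (suc m)
  snoc [ _ ]   f = f ∷ [ _ ]
  snoc (e ∷ W) f = e ∷ snoc W f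

  sign-snoc : (W : Walk x y m) (f : adj y z ≡ true) → sign (snoc W f) ≡ sign W · σ y z
  sign-snoc {y = y} {z = z} [ _ ] f = ·-comm (σ y z) pos
  sign-snoc (_ ∷ W) f = trans (cong (σ _ _ ·_) (sign-snoc W f)) (sym (·-assoc (σ _ _) (sign W) (σ _ _)))

  All-snoc : (W : Walk x y m) (f : adj y z ≡ true) → All Q (vertices W) → Q z →
    All Q (vertices (snoc W f))
  All-snoc [ _ ]   f (p ∷ []) q = p ∷ q ∷ []
  All-snoc (_ ∷ W) f (p ∷ ps) q = p ∷ All-snoc W f ps q

  reverse : Walk x y m → Walk y x m
  reverse [ x ]   = [ x ]
  reverse (e ∷ W) = snoc (reverse W) (adj-symmetric e)

  sign-reverse : (W : Walk x y m) → sign (reverse W) ≡ sign W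
  sign-reverse [ _ ] = refl
  sign-reverse (_∷_ {x} {y} e W) = trans (sign-snoc (reverse W) (adj-symmetric e))
    (trans (cong₂ _·_ (sign-reverse W) (σ-sym y x)) (·-comm (sign W) (σ x y)))

  All-reverse : (W : Walk x y m) → All Q (vertices W) → All Q (vertices (reverse W))
  All-reverse [ _ ]   qs       = qs
  All-reverse (e ∷ W) (q ∷ qs) = All-snoc (reverse W) (adj-symmetric e) (All-reverse W qs) q

  -- A view: matching on it turns the walk into `U ++ V` and its length into `a + b`, with no
  -- equations to transport along.
  data Split (z : Fin n) : ∀ {x y m} → Walk x y m → Set where
    _at_ : ∀ {a b x y} (U : Walk x z a) (V : Walk z y b) → Split z (U ++ V)

  split : (W : Walk x y m) → z ∈ᵛ vertices W → Split z W
  split W       (here refl) = [ _ ] at W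
  split (e ∷ W) (there z∈W) with split W z∈W
  ... | U at V = (e ∷ U) at V

  All-∈ : ∀ {vs : Vec (Fin n) m} → (∀ {z} → z ∈ᵛ vs → Q z) → All Q vs
  All-∈ {vs = vs} f = lookup⁻ λ i → f (∈-lookup i vs)

  -- If the first vertex recurs, the closed part before its recurrence is cut off. `Q` survives
  -- since only old vertices are visited. The strict decrease drives `toPath` and shows that a
  -- shortest walk is a path.
  shorten : (W : Walk x y m) → All Q (vertices W) → Unique (toList (vertices W)) ⊎
    (∃[ j ] (j < m × Σ[ W′ ∈ Walk x y j ] All Q (vertices W′)))
  shorten [ _ ] _ = inj₁ (List.[] ∷ [])
  shorten {x} (e ∷ W) (q ∷ qs) with shorten W qs
  ... | inj₂ (j , j<m , W′ , qs′) = inj₂ (suc j , s≤s j<m , e ∷ W′ , q ∷ qs′)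
  ... | inj₁ u with DecMem._∈?_ F._≟_ x (vertices W)
  ...   | no x∉W = inj₁ (List.¬Any⇒All¬ _ (x∉W ∘ ∈-toList⁻) ∷ u)
  ...   | yes x∈W with split W x∈W
  ...     | _at_ {a} {b} U V = inj₂ (b , s≤s (m≤n+m b a) , V , All-++⁻ʳ U V qs)

  toPath : Acc _<_ m → (W : Walk x y m) → All Q (vertices W) →
    ∃[ j ] (j ≤ m × Σ[ P ∈ Path graph x y j ] All Q (Path.vs P))
  toPath (acc rec) W qs with shorten W qs
  ... | inj₁ u = _ , ≤-refl , walk→path W u , qs
  ... | inj₂ (j , j<m , W′ , qs′) with toPath (rec j<m) W′ qs′
  ...   | i , i≤j , P = i , ≤-trans i≤j (<⇒≤ j<m) , P

  walk? : ∀ m {P : Walk x y m → Set} → Decidable P → Dec (∃ P)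
  walk? {x} {y} zero P? with x F.≟ y
  ... | no x≢y   = no λ { ([ _ ] , _) → x≢y refl }
  ... | yes refl = map′ (λ p → [ x ] , p) (λ { ([ _ ] , p) → p }) (P? [ x ])
  walk? {x} {y} (suc m) {P} P? = map′
    (λ { (v , e , W , p) → e ∷ W , p }) (λ { (e ∷ W , p) → _ , e , W , p })
    (F.any? via)
    where
    via : ∀ v → Dec (Σ[ e ∈ adj x v ≡ true ] Σ[ W ∈ Walk v y m ] P (e ∷ W))
    via v with adj x v Bool.≟ true
    ... | no ¬e = no (¬e ∘ proj₁)
    ... | yes e = map′ (e ,_)
      -- Proofs of adjacency are unique, so deciding `P` for the single proof `e` settles all of
      -- them.
      (λ { (e′ , W , p) → W , subst (λ e → P (e ∷ W)) (uip e′ e) p })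
      (walk? m (λ W → P? (e ∷ W)))

  bounded-walk? : ∀ r {P : ∀ {m} → Walk x y m → Set} → (∀ {m} (W : Walk x y m) → Dec (P W)) →
    Dec (∃[ m ] (m ≤ r × Σ[ W ∈ Walk x y m ] P W))
  bounded-walk? r P? = map′
    (λ { (m , s≤s m≤r , p) → m , m≤r , p }) (λ { (m , m≤r , p) → m , s≤s m≤r , p })
    (anyUpTo? (λ m → walk? m P?) (suc r))

  -- Weak reachability.

  module _ (L : Permutation′ n) (r : ℕ) where

    walk→WReachable : (W : Walk x y m) → m ≤ r →
      All (λ z → (L ⟨$⟩ʳ x) F.≤ (L ⟨$⟩ʳ z)) (vertices W) → WReachable graph L r y x
    walk→WReachable W m≤r qs =
      let j , j≤m , P = toPath (<-wellFounded _) W qs in j , ≤-trans j≤m m≤r , P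

    -- Removing loops keeps the lower bound by `x`, so walks and paths reach the same vertices, and
    -- walks of bounded length can be searched. Decidability yields the `Subset` that `HasSize`
    -- counts.
    WReachable? : ∀ y → Decidable (WReachable graph L r y)
    WReachable? y x = map′
      (λ { (_ , m≤r , W , qs) → walk→WReachable W m≤r qs })
      (λ { (m , m≤r , P , qs) → let W , eq = path→walk P in
             m , m≤r , W , subst (All _) (sym eq) qs })
      (bounded-walk? r (λ W → All.all? (λ z → (L ⟨$⟩ʳ x) F.≤? (L ⟨$⟩ʳ z)) (vertices W)))

    WReachable⇒≤ : WReachable graph L r y x → (L ⟨$⟩ʳ x) F.≤ (L ⟨$⟩ʳ y)
    WReachable⇒≤ {y} (_ , _ , P , qs) = subst (λ v → _ F.≤ (L ⟨$⟩ʳ v)) (Path.end P) (last-All _ qs)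
      where
      last-All : (vs : Vec (Fin n) (suc m)) → All Q vs → Q (last vs)
      last-All (_ ∷ [])     (q ∷ _)  = q
      last-All (_ ∷ v ∷ vs) (_ ∷ qs) = last-All (v ∷ vs) qs

    WReachable-refl : ∀ y → WReachable graph L r y y
    WReachable-refl y = walk→WReachable [ y ] z≤n (≤-refl ∷ [])

    WReachable-colouring : ∀ {w} → (∀ v s → HasSize (WReachable graph L r v) s → s ≤ w) →
      Σ[ φ ∈ (Fin n → Fin w) ] (∀ x y → WReachable graph L r y x → x ≢ y → φ x ≢ φ y)
    WReachable-colouring bound =
      let φ , proper = greedy-colouring L S (WReachable⇒≤ ∘ proj₁ (S-spec _ _))
                         (λ y → proj₂ (S-spec y y) (WReachable-refl y))
                         (λ y → bound y _ (S y , S-spec y , refl))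
      in φ , λ x y → proper x y ∘ proj₂ (S-spec y x)
      where
      S = λ y → proj₁ (decidable⇒subset (WReachable? y))
      S-spec = λ y → proj₂ (decidable⇒subset (WReachable? y))

  -- Half-balls.

  InHalfBall : ℕ → Walk x y m → Set
  -- Comparing `2 * m` with `k` avoids halving; for odd `k` the second alternative cannot occur.
  InHalfBall {m = m} k W = 2 * m < k ⊎ (2 * m ≡ k × sign W ≡ pos)

  HalfBall : ℕ → Fin n → Fin n → Set
  HalfBall k x z = ∃[ j ] Σ[ W ∈ Walk x z j ] InHalfBall k W

  InHalfBall⇒2*m≤k : {W : Walk x y m} → InHalfBall k W → 2 * m ≤ k
  InHalfBall⇒2*m≤k (inj₁ 2m<k)       = <⇒≤ 2m<k
  InHalfBall⇒2*m≤k (inj₂ (2m≡k , _)) = ≤-reflexive 2m≡k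

  HalfBall? : ∀ k x → Decidable (HalfBall k x)
  HalfBall? k x z = map′
    (λ { (j , _ , W , h) → j , W , h })
    (λ { (j , W , h) → j , ≤-trans (m≤n*m j 2) (InHalfBall⇒2*m≤k {W = W} h) , W , h })
    (bounded-walk? k (λ {m} W → (2 * m <? k) ⊎-dec ((2 * m ≟ k) ×-dec (sign W ≟ˢ pos))))

  HalfBall-refl : 1 ≤ k → ∀ x → HalfBall k x x
  HalfBall-refl 1≤k x = 0 , [ x ] , inj₁ 1≤k

  -- Initial segments of `W` are the witnesses. In the boundary case `2 * m ≡ k` a proper segment
  -- qualifies by being strictly shorter, and the full walk by its own sign.
  ∈-walk⇒HalfBall : (W : Walk x y m) → InHalfBall k W → All (HalfBall k x) (vertices W)
  ∈-walk⇒HalfBall {x} {k = k} W h = All-∈ λ z∈W → initial W h (split W z∈W)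
    where
    initial : ∀ {m y z} (W : Walk x y m) → InHalfBall k W → Split z W → HalfBall k x z
    initial _ (inj₁ lt) (_at_ {a} {b} U V) =
      a , U , inj₁ (≤-<-trans (*-monoʳ-≤ 2 (m≤m+n a b)) lt)
    initial _ (inj₂ (eq , s)) (_at_ {a} U [ _ ]) =
      a , U , inj₂ (trans (cong (2 *_) (sym (+-identityʳ a))) eq ,
                    trans (·-comm pos (sign U)) (trans (sym (sign-++ U [ _ ])) s))
    initial _ (inj₂ (eq , s)) (_at_ {a} {suc b} U (e ∷ V)) =
      a , U , inj₁ (<-≤-trans (*-monoʳ-< 2 (m<m+n a (s≤s z≤n))) (≤-reflexive eq))

  Dist⇒≤ : Dist graph x y k → Walk x y m → k ≤ m
  Dist⇒≤ {k = k} {m} (_ , shortest) W = ≮⇒≥ λ m<k →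
    let j , j≤m , P , _ = toPath {Q = λ z → z ≡ z} (<-wellFounded _) W (All.universal (λ _ → refl) _)
    in shortest j (≤-<-trans j≤m m<k) P

  -- `NegHat` speaks of paths, but a walk of length `k` between vertices at distance `k` repeats no
  -- vertex, since a shortcut would beat the distance. The separate equation `m ≡ k` admits
  -- concatenations of length `a + b`.
  NegHat⇒sign≡neg : NegHat Gσ k x y → (W : Walk x y m) → m ≡ k → sign W ≡ neg
  NegHat⇒sign≡neg (dist , negative) W refl
    with shorten {Q = λ z → z ≡ z} W (All.universal (λ _ → refl) _)
  ... | inj₁ u = negative (walk→path W u)
  ... | inj₂ (j , j<k , W′ , _) = contradiction (Dist⇒≤ dist W′) (<⇒≱ j<k)

  -- The walk through a common vertex has doubled length at most `2 * k`, and the distance forces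
  -- equality. Both witnesses are then positive of exactly half length, making the walk positive.
  HalfBall-disjoint : NegHat Gσ k x y → HalfBall k x z → ¬ HalfBall k y z
  HalfBall-disjoint {k} {x} {y} E@(dist , _) (a , U , hU) (b , V , hV) = absurd hU hV
    where
    W : Walk x y (a + b)
    W = U ++ reverse V

    doubled : 2 * (a + b) ≡ 2 * a + 2 * b
    doubled = *-distribˡ-+ 2 a b

    2*k≡k+k : 2 * k ≡ k + k
    2*k≡k+k = cong (k +_) (+-identityʳ k)

    not-short : ¬ 2 * a + 2 * b < k + k
    not-short lt = <⇒≱ lt (subst₂ _≤_ 2*k≡k+k doubled (*-monoʳ-≤ 2 (Dist⇒≤ dist W)))

    absurd : InHalfBall k U → ¬ InHalfBall k V
    absurd (inj₁ a<) _ = not-short (+-mono-<-≤ a< (InHalfBall⇒2*m≤k {W = V} hV))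
    absurd (inj₂ (a≡ , _)) (inj₁ b<) = not-short (+-mono-≤-< (≤-reflexive a≡) b<)
    absurd (inj₂ (a≡ , sU)) (inj₂ (b≡ , sV)) = pos≢neg (trans (sym sW) (NegHat⇒sign≡neg E W a+b≡k))
      where
      pos≢neg : pos ≢ neg
      pos≢neg ()
      sW : sign W ≡ pos
      sW = trans (sign-++ U (reverse V)) (cong₂ _·_ sU (trans (sign-reverse V) sV))
      a+b≡k : a + b ≡ k
      a+b≡k = *-cancelˡ-≡ (a + b) k 2 (trans doubled (trans (cong₂ _+_ a≡ b≡) (sym 2*k≡k+k)))

  -- Cut at `z`, the shorter piece is a witness from its own end. In a tie the signs of the pieces
  -- multiply to `neg`, so one of them is positive.
  negative⇒HalfBalls-cover : (W : Walk x y m) → sign W ≡ neg →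
    All (λ z → HalfBall m x z ⊎ HalfBall m y z) (vertices W)
  negative⇒HalfBalls-cover {x} {y} W sW = All-∈ λ z∈W → cover W sW (split W z∈W)
    where
    cover : ∀ {m z} (W : Walk x y m) → sign W ≡ neg → Split z W → HalfBall m x z ⊎ HalfBall m y z
    cover _ sW (_at_ {a} {b} U V) with <-cmp a b
    ... | tri< a<b _ _ = inj₁ (a , U ,
          inj₁ (+-monoʳ-< a (subst (_< b) (sym (+-identityʳ a)) a<b)))
    ... | tri> _ _ b<a = inj₂ (b , reverse V ,
          inj₁ (+-mono-<-≤ b<a (≤-reflexive (+-identityʳ b))))
    ... | tri≈ _ refl _ with sign U in sU
    ...   | pos = inj₁ (a , U , inj₂ (cong (a +_) (+-identityʳ a) , sU))
    ...   | neg = inj₂ (a , reverse V , inj₂ (cong (a +_) (+-identityʳ a) ,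
            trans (sign-reverse V) (neg·s≡neg (trans (cong (_· sign V) (sym sU)) (trans (sym (sign-++ U V)) sW)))))
      where
      neg·s≡neg : ∀ {s} → neg · s ≡ neg → s ≡ pos
      neg·s≡neg {pos} _ = refl

  -- Colouring each vertex through the least vertex of its half-ball.

  IsWcol⇒ChromaticAtMost : ∀ {r w} → 1 ≤ k → (∀ a b → 2 * a ≤ k → 2 * b ≤ k → a + (k + b) ≤ r) →
    IsWcol graph r w → ChromaticAtMost (NegHat Gσ k) w
  IsWcol⇒ChromaticAtMost {k} {r} {w} 1≤k radius ((L , bound , _) , _) = φ ∘ centre , proper
    where
    colouring = WReachable-colouring L r bound
    φ = proj₁ colouring

    leastInBall = λ x → least (λ z → toℕ (L ⟨$⟩ʳ z)) (HalfBall? k x) (x , HalfBall-refl 1≤k x)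

    centre : Fin n → Fin n
    centre x = proj₁ (leastInBall x)

    _⊑_ : Fin n → Fin n → Set
    u ⊑ v = (L ⟨$⟩ʳ u) F.≤ (L ⟨$⟩ʳ v)

    centre∈ : ∀ x → HalfBall k x (centre x)
    centre∈ x = proj₁ (proj₂ (leastInBall x))

    centre-least : ∀ {x z} → HalfBall k x z → centre x ⊑ z
    centre-least {x} {z} = proj₂ (proj₂ (leastInBall x)) z

    proper : ∀ x y → NegHat Gσ k x y → φ (centre x) ≢ φ (centre y)
    proper x y E@((P , _) , negative) = separated (centre∈ x) (centre∈ y)
      where
      W : Walk x y k
      W = proj₁ (path→walk P)

      inside-W : All (λ z → HalfBall k x z ⊎ HalfBall k y z) (vertices W)
      inside-W = negative⇒HalfBalls-cover W
        (trans (cong (signOf σ) (proj₂ (path→walk P))) (negative P))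

      centres-differ : centre x ≢ centre y
      centres-differ eq = HalfBall-disjoint E (centre∈ x) (subst (HalfBall k y) (sym eq) (centre∈ y))

      separated : HalfBall k x (centre x) → HalfBall k y (centre y) → φ (centre x) ≢ φ (centre y)
      separated (a , U , hU) (b , V , hV) = by-order (≤-total _ _)
        where
        route : Walk (centre x) (centre y) (a + (k + b))
        route = reverse U ++ W ++ V

        -- The parity of `k` enters only through `radius`.
        short : a + (k + b) ≤ r
        short = radius a b (InHalfBall⇒2*m≤k {W = U} hU) (InHalfBall⇒2*m≤k {W = V} hV)

        inside : All (λ z → HalfBall k x z ⊎ HalfBall k y z) (vertices route)
        inside = All-++⁺ (reverse U) (W ++ V) (All-reverse U (All.map inj₁ (∈-walk⇒HalfBall U hU)))
          (All-++⁺ W V inside-W (All.map inj₂ (∈-walk⇒HalfBall V hV)))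

        by-order : centre x ⊑ centre y ⊎ centre y ⊑ centre x → φ (centre x) ≢ φ (centre y)
        -- Each vertex of `route` lies above the centre of a half-ball containing it, hence above
        -- the smaller centre, from which the route must start.
        by-order (inj₁ x⊑y) = proj₂ colouring _ _
          (walk→WReachable L r route short (All.map
            (λ { (inj₁ h) → centre-least h ; (inj₂ h) → ≤-trans x⊑y (centre-least h) }) inside))
          centres-differ
        by-order (inj₂ y⊑x) = proj₂ colouring _ _
          (walk→WReachable L r (reverse route) short (All-reverse route (All.map
            (λ { (inj₁ h) → ≤-trans y⊑x (centre-least h) ; (inj₂ h) → centre-least h }) inside)))
          (centres-differ ∘ sym) ∘ sym

theorem7 : ∀ {n} (Gσ : SignedGraph n) (k : ℕ) → 1 ≤ k →
    (∀ w → IsWcol (SignedGraph.graph Gσ) (2 * k) w →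
    ChromaticAtMost (NegHat Gσ k) w) ×
    ((Σ ℕ λ j → k ≡ 1 + 2 * j) → ∀ w → IsWcol (SignedGraph.graph Gσ) (2 * k ∸ 1) w →
    ChromaticAtMost (NegHat Gσ k) w)
theorem7 Gσ k 1≤k = (λ w → IsWcol⇒ChromaticAtMost Gσ 1≤k even-radius) ,
                    (λ { (j , refl) w → IsWcol⇒ChromaticAtMost Gσ 1≤k (odd-radius j) })
  where
  regroup : ∀ a b k → a + (k + b) ≡ k + (a + b)
  regroup = solve-∀

  even-radius : ∀ a b → 2 * a ≤ k → 2 * b ≤ k → a + (k + b) ≤ 2 * k
  even-radius a b 2a≤k 2b≤k = begin
    a + (k + b)  ≡⟨ regroup a b k ⟩
    k + (a + b)  ≤⟨ +-monoʳ-≤ k (*-cancelˡ-≤ 2 2[a+b]≤2k) ⟩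
    k + k        ≡⟨ cong (k +_) (+-identityʳ k) ⟨
    2 * k        ∎
    where
    open ≤-Reasoning
    2[a+b]≤2k : 2 * (a + b) ≤ 2 * k
    2[a+b]≤2k = begin
      2 * (a + b)    ≡⟨ *-distribˡ-+ 2 a b ⟩
      2 * a + 2 * b  ≤⟨ +-mono-≤ 2a≤k 2b≤k ⟩
      k + k          ≡⟨ cong (k +_) (+-identityʳ k) ⟨
      2 * k          ∎

  -- For `k = 1 + 2 * j` each half-length rounds down to at most `j`, so `a + b` is at most `k ∸ 1`
  -- instead of `k`; this saves the one step.
  odd-radius : ∀ j a b → 2 * a ≤ 1 + 2 * j → 2 * b ≤ 1 + 2 * j →
    a + ((1 + 2 * j) + b) ≤ 2 * (1 + 2 * j) ∸ 1
  odd-radius j a b 2a≤ 2b≤ = begin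
    a + ((1 + 2 * j) + b)    ≡⟨ regroup a b (1 + 2 * j) ⟩
    (1 + 2 * j) + (a + b)    ≤⟨ +-monoʳ-≤ (1 + 2 * j) (+-mono-≤ (half a 2a≤) (half b 2b≤)) ⟩
    (1 + 2 * j) + (j + j)    ≡⟨ double j ⟩
    2 * (1 + 2 * j) ∸ 1      ∎
    where
    open ≤-Reasoning
    half : ∀ c → 2 * c ≤ 1 + 2 * j → c ≤ j
    -- Otherwise `2 * j + 2 ≤ 2 * c ≤ 2 * j + 1`.
    half c 2c≤ = ≮⇒≥ λ j<c → <⇒≱ (s≤s (n<1+n (2 * j)))
      (≤-trans (≤-trans (≤-reflexive (sym (*-suc 2 j))) (*-monoʳ-≤ 2 j<c)) 2c≤)
    -- The right side is what `2 * (1 + 2 * j) ∸ 1` computes to, written as a semiring expression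
    -- for the solver.
    double : ∀ j → (1 + 2 * j) + (j + j) ≡ 2 * j + (1 + (2 * j + 0))
    double = solve-∀
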